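{- Let $(r_I)_I$ be a family of idempotent functions $r_I:[0,1]^I\times[0,1]\to[0,1]^I\times[0,1]$ satisfying (1) $r_I(u,z)=(u,z)$ iff $\partial_I u=1$ or $z=0$, and (2) $r_J(f\times\mathrm{id})r_I=r_J(f\times\mathrm{id})$ for every strict $f\in\mathrm{Hom}(I,J)$. Let $(r_\psi)$, for $I$ a finite set of names and $\psi\in\mathbb{F}(I)$, be functions $[0,1]^I\times[0,1]\to[0,1]^I\times[0,1]$ satisfying: (a) $r_\psi=\mathrm{id}$ if $\psi=1_\mathbb{F}$; (b) $r_\psi=r_\psi r_I$ if $\psi\neq1_\mathbb{F}$; (c) $r_\psi(u,z)=(u,z)$ if $z=0$; (d) $r_\psi((ib)\times\mathrm{id})=((ib)\times\mathrm{id})r_{\psi(ib)}$ for $i\in I$, $b\in\{0,1\}$. Then for every morphism $f\in\mathrm{Hom}(I,J)$ and every $\psi\in\mathbb{F}(J)$, $$r_\psi\circ(f\times\mathrm{id})=(f\times\mathrm{id})\circ r_{\psi f}.$$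
   Context: Fix a countably infinite set of names. $\mathsf{dM}(J)$ is the free de Morgan algebra on $J$. The cube category $\mathcal{C}$ has finite sets of names as objects; $f\in\mathrm{Hom}(I,J)$ is a map $J\to\mathsf{dM}(I)$, composed by substitution; $f$ is strict if it never takes value $0$ or $1$. Using the de Morgan algebra $([0,1],\min,\max,1-x)$, $f\in\mathrm{Hom}(I,J)$ induces $f:[0,1]^I\to[0,1]^J$, $(fu)_j=f(j)$ evaluated at $u$. The face map $(ib)\in\mathrm{Hom}(I-\{i\},I)$ sends $i\mapsto b$, $j\mapsto j$ otherwise. The face lattice $\mathbb{F}$ is the distributive lattice generated by $(i=0),(i=1)$ for names $i$ subject to $(i=0)\wedge(i=1)=0_\mathbb{F}$; $\mathbb{F}(I)$ is the sublattice generated by generators with $i\in I$. For $\psi\in\mathbb{F}(J)$ and $f\in\mathrm{Hom}(I,J)$, $\psi f\in\mathbb{F}(I)$ is the substitution sending $(j=1)$ to $(f(j)=1)$ and $(j=0)$ to $(1-f(j)=1)$, where $r\mapsto(r=1)$ is the lattice map $\mathsf{dM}(I)\to\mathbb{F}(I)$ with $i\mapsto(i=1)$, $1-i\mapsto(i=0)$, $0\mapsto 0_\mathbb{F}$, $1\mapsto1_\mathbb{F}$; in particular $\psi(ib)$ substitutes $(i=b)\mapsto 1_\mathbb{F}$, $(i=1-b)\mapsto 0_\mathbb{F}$. For $u\in[0,1]^I$, $\partial_I u=1$ means some $u_i\in\{0,1\}$. -}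

module Defs where

open import Algebra.Core using (Op₁; Op₂)
open import Algebra.Definitions using (Identity; Involutive; Congruent₁)
open import Algebra.Lattice.Bundles using (DistributiveLattice)
import Algebra.Properties.Group as GroupProperties
open import Data.Bool.Base using (Bool; if_then_else_)
open import Data.List.Base using (List; filter)
open import Data.List.Membership.Propositional using (_∈_)
open import Data.List.Membership.Propositional.Properties using (∈-filter⁺)
open import Data.List.Relation.Unary.Linked using (Linked)
import Data.List.Relation.Unary.Linked.Properties as Linked
open import Data.Nat.Base as ℕ using (ℕ)
import Data.Nat.Properties as ℕ
open import Data.Product.Base using (_×_; _,_; ∃; proj₁; proj₂; map₁; swap)
open import Data.Product.Relation.Binary.Pointwise.NonDependent using (_×ₛ_)
open import Data.Rational.Base using (ℚ; 0ℚ; 1ℚ; _<_; _-_; -_; _+_)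
import Data.Rational.Properties as ℚ
open import Data.Sum.Base using (_⊎_; inj₁; inj₂; [_,_]; [_,_]′)
import Data.Sum.Base as Sum
open import Function.Base using (_on_)
open import Level using (Level; 0ℓ) renaming (suc to lsuc; _⊔_ to _⊔ℓ_)
open import Relation.Binary.Bundles using (Setoid)
import Relation.Binary.Construct.On as On
open import Relation.Binary.Definitions using (tri<; tri≈; tri>)
open import Relation.Binary.PropositionalEquality.Core using (_≡_; refl; sym; trans; cong; subst)
open import Relation.Nullary using (¬_; yes; no; ¬?)
open import Relation.Unary using (Pred; _∩_; _∪_; _⊆_; _≐_)
import Relation.Unary.Algebra as Pred
import Relation.Unary.Properties as Pred

private variable
  c ℓ : Level
  X Y : Set

-- Boundedness is stated through identity laws; the dual De Morgan law and
-- ~ ⊥ ≈ ⊤ follow from the fields below.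
record DeMorganAlgebra c ℓ : Set (lsuc (c ⊔ℓ ℓ)) where
  field
    distributiveLattice : DistributiveLattice c ℓ
  open DistributiveLattice distributiveLattice public
  infix 8 ~_
  field
    ⊥ ⊤          : Carrier
    ~_           : Op₁ Carrier
    ∨-identity   : Identity _≈_ ⊥ _∨_
    ∧-identity   : Identity _≈_ ⊤ _∧_
    ~-cong       : Congruent₁ _≈_ ~_
    ~-involutive : Involutive _≈_ ~_
    deMorgan     : ∀ x y → ~ (x ∧ y) ≈ ~ x ∨ ~ y

-- The free De Morgan algebra on X: terms modulo the congruence _≈ᴰ_
-- generated by the axioms.
infix  8 ~_
infixr 7 _∧_
infixr 6 _∨_
infix  4 _≈ᴰ_

data DM (X : Set) : Set where
  var     : X → DM X
  𝟎 𝟏     : DM X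
  _∧_ _∨_ : DM X → DM X → DM X
  ~_      : DM X → DM X

data _≈ᴰ_ {X : Set} : DM X → DM X → Set where
  ≈-refl    : ∀ {s} → s ≈ᴰ s
  ≈-sym     : ∀ {s t} → s ≈ᴰ t → t ≈ᴰ s
  ≈-trans   : ∀ {s t u} → s ≈ᴰ t → t ≈ᴰ u → s ≈ᴰ u
  ∧-cong    : ∀ {s s′ t t′} → s ≈ᴰ s′ → t ≈ᴰ t′ → s ∧ t ≈ᴰ s′ ∧ t′
  ∨-cong    : ∀ {s s′ t t′} → s ≈ᴰ s′ → t ≈ᴰ t′ → s ∨ t ≈ᴰ s′ ∨ t′
  ~-cong    : ∀ {s s′} → s ≈ᴰ s′ → ~ s ≈ᴰ ~ s′
  ∧-comm    : ∀ s t → s ∧ t ≈ᴰ t ∧ s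
  ∨-comm    : ∀ s t → s ∨ t ≈ᴰ t ∨ s
  ∧-assoc   : ∀ s t u → (s ∧ t) ∧ u ≈ᴰ s ∧ (t ∧ u)
  ∨-assoc   : ∀ s t u → (s ∨ t) ∨ u ≈ᴰ s ∨ (t ∨ u)
  ∧-absorbs : ∀ s t → s ∧ (s ∨ t) ≈ᴰ s
  ∨-absorbs : ∀ s t → s ∨ (s ∧ t) ≈ᴰ s
  ∧-distrib : ∀ s t u → s ∧ (t ∨ u) ≈ᴰ (s ∧ t) ∨ (s ∧ u)
  ∨-distrib : ∀ s t u → s ∨ (t ∧ u) ≈ᴰ (s ∨ t) ∧ (s ∨ u)
  ∧-unit    : ∀ s → 𝟏 ∧ s ≈ᴰ s
  ∨-unit    : ∀ s → 𝟎 ∨ s ≈ᴰ s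
  ~-invol   : ∀ s → ~ (~ s) ≈ᴰ s
  deMorgan  : ∀ s t → ~ (s ∧ t) ≈ᴰ ~ s ∨ ~ t

dM : Set → DeMorganAlgebra 0ℓ 0ℓ
dM X = record
  { distributiveLattice = record
    { Carrier = DM X ; _≈_ = _≈ᴰ_ ; _∨_ = _∨_ ; _∧_ = _∧_
    ; isDistributiveLattice = record
      { isLattice = record
        { isEquivalence = record { refl = ≈-refl ; sym = ≈-sym ; trans = ≈-trans }
        ; ∨-comm = ∨-comm ; ∨-assoc = ∨-assoc ; ∨-cong = ∨-cong
        ; ∧-comm = ∧-comm ; ∧-assoc = ∧-assoc ; ∧-cong = ∧-cong
        ; absorptive = ∨-absorbs , ∧-absorbs
        }
      ; ∨-distrib-∧ = ∨-distrib , λ s t u →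
          ≈-trans (∨-comm _ s) (≈-trans (∨-distrib s t u) (∧-cong (∨-comm s t) (∨-comm s u)))
      ; ∧-distrib-∨ = ∧-distrib , λ s t u →
          ≈-trans (∧-comm _ s) (≈-trans (∧-distrib s t u) (∨-cong (∧-comm s t) (∧-comm s u)))
      }
    }
  ; ⊥ = 𝟎 ; ⊤ = 𝟏 ; ~_ = ~_
  ; ∨-identity = ∨-unit , λ s → ≈-trans (∨-comm s 𝟎) (∨-unit s)
  ; ∧-identity = ∧-unit , λ s → ≈-trans (∧-comm s 𝟏) (∧-unit s)
  ; ~-cong = ~-cong ; ~-involutive = ~-invol ; deMorgan = deMorgan
  }

module _ (A : DeMorganAlgebra c ℓ) where
  private module A = DeMorganAlgebra A

  eval : DM X → (X → A.Carrier) → A.Carrier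
  eval (var x) u = u x
  eval 𝟎       u = A.⊥
  eval 𝟏       u = A.⊤
  eval (s ∧ t) u = eval s u A.∧ eval t u
  eval (s ∨ t) u = eval s u A.∨ eval t u
  eval (~ s)   u = A.~ eval s u

-- Located two-sided Dedekind cuts.
record ℝ : Set₁ where
  field
    L U      : Pred ℚ 0ℓ
    L-inhab  : ∃ L
    U-inhab  : ∃ U
    L-lower  : ∀ {p q} → p < q → L q → L p
    U-upper  : ∀ {p q} → p < q → U p → U q
    L-open   : ∀ {p} → L p → ∃ λ q → p < q × L q
    U-open   : ∀ {q} → U q → ∃ λ p → p < q × U p
    disjoint : ∀ {q} → L q → ¬ U q
    located  : ∀ {p q} → p < q → L p ⊎ U q
open ℝ

infix 4 _≈ᴿ_ _≤ᴿ_

_≈ᴿ_ : ℝ → ℝ → Set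
x ≈ᴿ y = L x ≐ L y × U x ≐ U y

_≤ᴿ_ : ℝ → ℝ → Set
x ≤ᴿ y = L x ⊆ L y × U y ⊆ U x

private
  pred succ : ℚ → ℚ
  pred p = p + (- 1ℚ)
  succ p = p + 1ℚ

  p-1<p : ∀ p → pred p < p
  p-1<p p = subst (pred p <_) (ℚ.+-identityʳ p) (ℚ.+-monoʳ-< p (ℚ.neg-antimono-< (ℚ.positive⁻¹ 1ℚ)))

  p<p+1 : ∀ p → p < succ p
  p<p+1 p = subst (_< succ p) (ℚ.+-identityʳ p) (ℚ.+-monoʳ-< p (ℚ.positive⁻¹ 1ℚ))

fromℚ : ℚ → ℝ
fromℚ p = record
  { L        = _< p
  ; U        = p <_
  ; L-inhab  = pred p , p-1<p p
  ; U-inhab  = succ p , p<p+1 p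
  ; L-lower  = ℚ.<-trans
  ; U-upper  = λ q<r p<q → ℚ.<-trans p<q q<r
  ; L-open   = λ q<p → let m , q<m , m<p = ℚ.<-dense q<p in m , q<m , m<p
  ; U-open   = λ p<q → let m , p<m , m<q = ℚ.<-dense p<q in m , m<q , p<m
  ; disjoint = ℚ.<-asym
  ; located  = loc
  }
  where
  loc : ∀ {q r} → q < r → q < p ⊎ p < r
  loc {q} q<r with ℚ.<-cmp q p
  ... | tri< q<p _ _    = inj₁ q<p
  ... | tri≈ _ refl _   = inj₂ q<r
  ... | tri> _ _ p<q    = inj₂ (ℚ.<-trans p<q q<r)

private
  ∩-lower : ∀ {P Q : Pred ℚ 0ℓ} → (∀ {p q} → p < q → P q → P p) →
            (∀ {p q} → p < q → Q q → Q p) → ∀ {p q} → P p → Q q →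
            ∃ λ r → (r ≡ p ⊎ r ≡ q) × (P ∩ Q) r
  ∩-lower P↓ Q↓ {p} {q} Pp Qq with ℚ.<-cmp p q
  ... | tri< p<q _ _  = p , inj₁ refl , Pp , Q↓ p<q Qq
  ... | tri≈ _ refl _ = p , inj₁ refl , Pp , Qq
  ... | tri> _ _ q<p  = q , inj₂ refl , P↓ q<p Pp , Qq

  ∩-upper : ∀ {P Q : Pred ℚ 0ℓ} → (∀ {p q} → p < q → P p → P q) →
            (∀ {p q} → p < q → Q p → Q q) → ∀ {p q} → P p → Q q →
            ∃ λ r → (r ≡ p ⊎ r ≡ q) × (P ∩ Q) r
  ∩-upper P↑ Q↑ {p} {q} Pp Qq with ℚ.<-cmp p q
  ... | tri< p<q _ _  = q , inj₂ refl , P↑ p<q Pp , Qq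
  ... | tri≈ _ refl _ = p , inj₁ refl , Pp , Qq
  ... | tri> _ _ q<p  = p , inj₁ refl , Pp , Q↑ q<p Qq

infixr 7 _minᴿ_
infixr 6 _maxᴿ_

_minᴿ_ : ℝ → ℝ → ℝ
x minᴿ y = record
  { L        = L x ∩ L y
  ; U        = U x ∪ U y
  ; L-inhab  = let r , _ , Lr = ∩-lower {L x} {L y} (L-lower x) (L-lower y)
                                  (proj₂ (L-inhab x)) (proj₂ (L-inhab y)) in r , Lr
  ; U-inhab  = let q , Uq = U-inhab x in q , inj₁ Uq
  ; L-lower  = λ p<q (Lx , Ly) → L-lower x p<q Lx , L-lower y p<q Ly
  ; U-upper  = λ p<q → Sum.map (U-upper x p<q) (U-upper y p<q)
  ; L-open   = λ {p} (Lx , Ly) →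
      let q₁ , p<q₁ , Lx′ = L-open x Lx
          q₂ , p<q₂ , Ly′ = L-open y Ly
          r , r≡ , Lr     = ∩-lower {L x} {L y} (L-lower x) (L-lower y) Lx′ Ly′
      in r , [ (λ e → subst (p <_) (sym e) p<q₁) , (λ e → subst (p <_) (sym e) p<q₂) ]′ r≡ , Lr
  ; U-open   = [ (λ Ux → let p , p<q , Ux′ = U-open x Ux in p , p<q , inj₁ Ux′)
               , (λ Uy → let p , p<q , Uy′ = U-open y Uy in p , p<q , inj₂ Uy′) ]
  ; disjoint = λ (Lx , Ly) → [ disjoint x Lx , disjoint y Ly ]
  ; located  = loc
  }
  where
  loc : ∀ {p q} → p < q → (L x ∩ L y) p ⊎ (U x ∪ U y) q
  loc p<q with located x p<q | located y p<q
  ... | inj₁ Lx | inj₁ Ly = inj₁ (Lx , Ly)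
  ... | inj₂ Ux | _       = inj₂ (inj₁ Ux)
  ... | inj₁ _  | inj₂ Uy = inj₂ (inj₂ Uy)

_maxᴿ_ : ℝ → ℝ → ℝ
x maxᴿ y = record
  { L        = L x ∪ L y
  ; U        = U x ∩ U y
  ; L-inhab  = let p , Lp = L-inhab x in p , inj₁ Lp
  ; U-inhab  = let r , _ , Ur = ∩-upper {U x} {U y} (U-upper x) (U-upper y)
                                  (proj₂ (U-inhab x)) (proj₂ (U-inhab y)) in r , Ur
  ; L-lower  = λ p<q → Sum.map (L-lower x p<q) (L-lower y p<q)
  ; U-upper  = λ p<q (Ux , Uy) → U-upper x p<q Ux , U-upper y p<q Uy
  ; L-open   = [ (λ Lx → let q , p<q , Lx′ = L-open x Lx in q , p<q , inj₁ Lx′)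
               , (λ Ly → let q , p<q , Ly′ = L-open y Ly in q , p<q , inj₂ Ly′) ]
  ; U-open   = λ {q} (Ux , Uy) →
      let p₁ , p₁<q , Ux′ = U-open x Ux
          p₂ , p₂<q , Uy′ = U-open y Uy
          r , r≡ , Ur     = ∩-upper {U x} {U y} (U-upper x) (U-upper y) Ux′ Uy′
      in r , [ (λ e → subst (_< q) (sym e) p₁<q) , (λ e → subst (_< q) (sym e) p₂<q) ]′ r≡ , Ur
  ; disjoint = λ LL (Ux , Uy) → [ (λ Lx → disjoint x Lx Ux) , (λ Ly → disjoint y Ly Uy) ] LL
  ; located  = loc
  }
  where
  loc : ∀ {p q} → p < q → (L x ∪ L y) p ⊎ (U x ∩ U y) q
  loc p<q with located x p<q | located y p<q
  ... | inj₂ Ux | inj₂ Uy = inj₂ (Ux , Uy)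
  ... | inj₁ Lx | _       = inj₁ (inj₁ Lx)
  ... | inj₂ _  | inj₁ Ly = inj₁ (inj₂ Ly)

private
  1-1- : ∀ p → 1ℚ - (1ℚ - p) ≡ p
  1-1- p = trans (cong (1ℚ +_) (ℚ.neg-distrib-+ 1ℚ (- p)))
          (trans (sym (ℚ.+-assoc 1ℚ (- 1ℚ) (- (- p))))
          (trans (ℚ.+-identityˡ (- (- p)))
                 (GroupProperties.⁻¹-involutive ℚ.+-0-group p)))

  1-anti : ∀ {p q} → p < q → 1ℚ - q < 1ℚ - p
  1-anti p<q = ℚ.+-monoʳ-< 1ℚ (ℚ.neg-antimono-< p<q)

  1-swapˡ : ∀ {p q} → 1ℚ - p < q → 1ℚ - q < p
  1-swapˡ {p} {q} h = subst (1ℚ - q <_) (1-1- p) (1-anti h)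

  1-swapʳ : ∀ {p q} → p < 1ℚ - q → q < 1ℚ - p
  1-swapʳ {p} {q} h = subst (_< 1ℚ - p) (1-1- q) (1-anti h)

-- 1 - x:  q < 1 - x  iff  x < 1 - q,  and dually.
1-ᴿ_ : ℝ → ℝ
1-ᴿ x = record
  { L        = λ q → U x (1ℚ - q)
  ; U        = λ q → L x (1ℚ - q)
  ; L-inhab  = let q , Uq = U-inhab x in 1ℚ - q , subst (U x) (sym (1-1- q)) Uq
  ; U-inhab  = let q , Lq = L-inhab x in 1ℚ - q , subst (L x) (sym (1-1- q)) Lq
  ; L-lower  = λ p<q → U-upper x (1-anti p<q)
  ; U-upper  = λ p<q → L-lower x (1-anti p<q)
  ; L-open   = λ Up → let q , q< , Uq = U-open x Up in
                 1ℚ - q , 1-swapʳ q< , subst (U x) (sym (1-1- q)) Uq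
  ; U-open   = λ Lq → let p , <p , Lp = L-open x Lq in
                 1ℚ - p , 1-swapˡ <p , subst (L x) (sym (1-1- p)) Lp
  ; disjoint = λ Uq Lq → disjoint x Lq Uq
  ; located  = λ p<q → Sum.swap (located x (1-anti p<q))
  }

record Interval : Set₁ where
  constructor interval
  field
    real : ℝ
    0≤   : fromℚ 0ℚ ≤ᴿ real
    ≤1   : real ≤ᴿ fromℚ 1ℚ
open Interval

infix 4 _≈ᴵ_
_≈ᴵ_ : Interval → Interval → Set
_≈ᴵ_ = _≈ᴿ_ on real

private
  0<1 : 0ℚ < 1ℚ
  0<1 = ℚ.positive⁻¹ 1ℚ

  ≤ᴿ-refl : ∀ {x} → x ≤ᴿ x
  ≤ᴿ-refl = (λ l → l) , (λ u → u)

  0≤1 : fromℚ 0ℚ ≤ᴿ fromℚ 1ℚ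
  0≤1 = (λ q<0 → ℚ.<-trans q<0 0<1) , (λ 1<q → ℚ.<-trans 0<1 1<q)

0ᴵ 1ᴵ : Interval
0ᴵ = interval (fromℚ 0ℚ) (≤ᴿ-refl {fromℚ 0ℚ}) 0≤1
1ᴵ = interval (fromℚ 1ℚ) 0≤1 (≤ᴿ-refl {fromℚ 1ℚ})

_minᴵ_ _maxᴵ_ : Interval → Interval → Interval
interval x (0≤x , 0≤x′) (x≤1 , x≤1′) minᴵ interval y (0≤y , 0≤y′) (y≤1 , y≤1′) =
  interval (x minᴿ y)
    ((λ l → 0≤x l , 0≤y l) , [ 0≤x′ , 0≤y′ ])
    ((λ l → x≤1 (proj₁ l)) , (λ u → inj₁ (x≤1′ u)))
interval x (0≤x , 0≤x′) (x≤1 , x≤1′) maxᴵ interval y (0≤y , 0≤y′) (y≤1 , y≤1′) =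
  interval (x maxᴿ y)
    ((λ l → inj₁ (0≤x l)) , (λ u → 0≤x′ (proj₁ u)))
    ([ x≤1 , y≤1 ] , (λ u → x≤1′ u , y≤1′ u))

1-ᴵ_ : Interval → Interval
1-ᴵ interval x (0≤x , 0≤x′) (x≤1 , x≤1′) = interval (1-ᴿ x)
  ( (λ {q} q<0 → x≤1′ (1-anti q<0))
  , (λ {q} l → 1-swapˡ {q} {1ℚ} (x≤1 l)))
  ( (λ {q} u → 1-swapʳ {0ℚ} {q} (0≤x′ u))
  , (λ {q} 1<q → 0≤x (1-anti 1<q)))

𝕀 : DeMorganAlgebra (lsuc 0ℓ) 0ℓ
𝕀 = record
  { distributiveLattice = record
    { Carrier = Interval ; _≈_ = _≈ᴵ_ ; _∨_ = _maxᴵ_ ; _∧_ = _minᴵ_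
    ; isDistributiveLattice = record
      { isLattice = record
        { isEquivalence = record
          { refl  = Pred.≐-refl , Pred.≐-refl
          ; sym   = λ (l , u) → swap l , swap u
          ; trans = λ (l , u) (l′ , u′) → Pred.≐-trans l l′ , Pred.≐-trans u u′
          }
        ; ∨-comm  = λ (interval x _ _) (interval y _ _) → Pred.∪-comm (L x) (L y) , Pred.∩-comm (U x) (U y)
        ; ∨-assoc = λ (interval x _ _) (interval y _ _) (interval z _ _) →
            Pred.∪-assoc (L x) (L y) (L z) , Pred.∩-assoc (U x) (U y) (U z)
        ; ∨-cong  = λ (l , u) (l′ , u′) → Pred.∪-cong l l′ , Pred.∩-cong u u′
        ; ∧-comm  = λ (interval x _ _) (interval y _ _) → Pred.∩-comm (L x) (L y) , Pred.∪-comm (U x) (U y)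
        ; ∧-assoc = λ (interval x _ _) (interval y _ _) (interval z _ _) →
            Pred.∩-assoc (L x) (L y) (L z) , Pred.∪-assoc (U x) (U y) (U z)
        ; ∧-cong  = λ (l , u) (l′ , u′) → Pred.∩-cong l l′ , Pred.∪-cong u u′
        ; absorptive =
            (λ (interval x _ _) (interval y _ _) → Pred.∪-abs-∩ (L x) (L y) , Pred.∩-abs-∪ (U x) (U y))
          , (λ (interval x _ _) (interval y _ _) → Pred.∩-abs-∪ (L x) (L y) , Pred.∪-abs-∩ (U x) (U y))
        }
      ; ∨-distrib-∧ =
          (λ (interval x _ _) (interval y _ _) (interval z _ _) →
            Pred.∪-distribˡ-∩ (L x) (L y) (L z) , Pred.∩-distribˡ-∪ (U x) (U y) (U z))
        , (λ (interval x _ _) (interval y _ _) (interval z _ _) →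
            Pred.∪-distribʳ-∩ (L x) (L y) (L z) , Pred.∩-distribʳ-∪ (U x) (U y) (U z))
      ; ∧-distrib-∨ =
          (λ (interval x _ _) (interval y _ _) (interval z _ _) →
            Pred.∩-distribˡ-∪ (L x) (L y) (L z) , Pred.∪-distribˡ-∩ (U x) (U y) (U z))
        , (λ (interval x _ _) (interval y _ _) (interval z _ _) →
            Pred.∩-distribʳ-∪ (L x) (L y) (L z) , Pred.∪-distribʳ-∩ (U x) (U y) (U z))
      }
    }
  ; ⊥ = 0ᴵ ; ⊤ = 1ᴵ ; ~_ = 1-ᴵ_
  ; ∨-identity = identityˡ , identityʳ
  ; ∧-identity = identityˡ′ , identityʳ′
  ; ~-cong = λ ((l , l′) , (u , u′)) → (u , u′) , (l , l′)
  ; ~-involutive = λ (interval x _ _) →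
      ((λ {q} → subst (L x) (1-1- q)) , (λ {q} → subst (L x) (sym (1-1- q))))
    , ((λ {q} → subst (U x) (1-1- q)) , (λ {q} → subst (U x) (sym (1-1- q))))
  ; deMorgan = λ x y → Pred.≐-refl , Pred.≐-refl
  }
  where
  identityˡ : ∀ x → 0ᴵ maxᴵ x ≈ᴵ x
  identityˡ x = ([ proj₁ (0≤ x) , (λ l → l) ] , inj₂) , (proj₂ , (λ u → proj₂ (0≤ x) u , u))
  identityʳ : ∀ x → x maxᴵ 0ᴵ ≈ᴵ x
  identityʳ x = ([ (λ l → l) , proj₁ (0≤ x) ] , inj₁) , (proj₁ , (λ u → u , proj₂ (0≤ x) u))
  identityˡ′ : ∀ x → 1ᴵ minᴵ x ≈ᴵ x
  identityˡ′ x = (proj₂ , (λ l → proj₁ (≤1 x) l , l)) , ([ proj₂ (≤1 x) , (λ u → u) ] , inj₂)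
  identityʳ′ : ∀ x → x minᴵ 1ᴵ ≈ᴵ x
  identityʳ′ x = (proj₁ , (λ l → l , proj₁ (≤1 x) l)) , ([ (λ u → u) , proj₂ (≤1 x) ] , inj₁)

-- Finite sets of names need a canonical form below, so the countably infinite
-- set of names is taken to be ℕ.
Name : Set
Name = ℕ

-- Strictly increasing lists, so that equality of finite sets is equality of
-- their lists.
record FinSet : Set where
  constructor finSet
  field
    names   : List Name
    .sorted : Linked ℕ._<_ names
open FinSet

-- The irrelevant membership proof makes elements equal when their names are.
record El (I : FinSet) : Set where
  constructor el
  field
    name : Name
    .mem : name ∈ names I
open El

infixl 6 _∖_
_∖_ : FinSet → Name → FinSet
finSet is s ∖ i =
  finSet (filter (λ j → ¬? (j ℕ.≟ i)) is) (Linked.filter⁺ (λ j → ¬? (j ℕ.≟ i)) ℕ.<-trans s)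

-- Morphisms are represented by terms; values are compared with _≈ᴰ_.
Hom : FinSet → FinSet → Set
Hom I J = El J → DM (El I)

Strict : ∀ {I J} → Hom I J → Set
Strict f = ∀ j → ¬ (f j ≈ᴰ 𝟎) × ¬ (f j ≈ᴰ 𝟏)

endpoint : Bool → DM X
endpoint b = if b then 𝟏 else 𝟎

face : ∀ {I} (i : El I) → Bool → Hom (I ∖ name i) I
face i b (el j j∈I) with j ℕ.≟ name i
... | yes _  = endpoint b
... | no j≢i = var (el j (∈-filter⁺ (λ k → ¬? (k ℕ.≟ name i)) j∈I j≢i))

infixr 7 _∧ᶠ_
infixr 6 _∨ᶠ_
infix  4 _≈ᶠ_

-- The bounded distributive lattice presented by (x = 0), (x = 1) with
-- (x = 0) ∧ (x = 1) = 0: terms modulo the generated congruence _≈ᶠ_.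
data Face (X : Set) : Set where
  ⟨_=0⟩ ⟨_=1⟩ : X → Face X
  0𝔽 1𝔽       : Face X
  _∧ᶠ_ _∨ᶠ_   : Face X → Face X → Face X

data _≈ᶠ_ {X : Set} : Face X → Face X → Set where
  ≈-refl    : ∀ {φ} → φ ≈ᶠ φ
  ≈-sym     : ∀ {φ ψ} → φ ≈ᶠ ψ → ψ ≈ᶠ φ
  ≈-trans   : ∀ {φ ψ χ} → φ ≈ᶠ ψ → ψ ≈ᶠ χ → φ ≈ᶠ χ
  ∧-cong    : ∀ {φ φ′ ψ ψ′} → φ ≈ᶠ φ′ → ψ ≈ᶠ ψ′ → φ ∧ᶠ ψ ≈ᶠ φ′ ∧ᶠ ψ′
  ∨-cong    : ∀ {φ φ′ ψ ψ′} → φ ≈ᶠ φ′ → ψ ≈ᶠ ψ′ → φ ∨ᶠ ψ ≈ᶠ φ′ ∨ᶠ ψ′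
  ∧-comm    : ∀ φ ψ → φ ∧ᶠ ψ ≈ᶠ ψ ∧ᶠ φ
  ∨-comm    : ∀ φ ψ → φ ∨ᶠ ψ ≈ᶠ ψ ∨ᶠ φ
  ∧-assoc   : ∀ φ ψ χ → (φ ∧ᶠ ψ) ∧ᶠ χ ≈ᶠ φ ∧ᶠ (ψ ∧ᶠ χ)
  ∨-assoc   : ∀ φ ψ χ → (φ ∨ᶠ ψ) ∨ᶠ χ ≈ᶠ φ ∨ᶠ (ψ ∨ᶠ χ)
  ∧-absorbs : ∀ φ ψ → φ ∧ᶠ (φ ∨ᶠ ψ) ≈ᶠ φ
  ∨-absorbs : ∀ φ ψ → φ ∨ᶠ (φ ∧ᶠ ψ) ≈ᶠ φ
  ∧-distrib : ∀ φ ψ χ → φ ∧ᶠ (ψ ∨ᶠ χ) ≈ᶠ (φ ∧ᶠ ψ) ∨ᶠ (φ ∧ᶠ χ)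
  ∨-distrib : ∀ φ ψ χ → φ ∨ᶠ (ψ ∧ᶠ χ) ≈ᶠ (φ ∨ᶠ ψ) ∧ᶠ (φ ∨ᶠ χ)
  ∧-unit    : ∀ φ → 1𝔽 ∧ᶠ φ ≈ᶠ φ
  ∨-unit    : ∀ φ → 0𝔽 ∨ᶠ φ ≈ᶠ φ
  0∧1-empty : ∀ x → ⟨ x =0⟩ ∧ᶠ ⟨ x =1⟩ ≈ᶠ 0𝔽

face-setoid : Set → Setoid 0ℓ 0ℓ
face-setoid X = record
  { Carrier = Face X ; _≈_ = _≈ᶠ_
  ; isEquivalence = record { refl = ≈-refl ; sym = ≈-sym ; trans = ≈-trans } }

mapᶠ : (X → Y) → Face X → Face Y
mapᶠ g ⟨ x =0⟩  = ⟨ g x =0⟩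
mapᶠ g ⟨ x =1⟩  = ⟨ g x =1⟩
mapᶠ g 0𝔽       = 0𝔽
mapᶠ g 1𝔽       = 1𝔽
mapᶠ g (φ ∧ᶠ ψ) = mapᶠ g φ ∧ᶠ mapᶠ g ψ
mapᶠ g (φ ∨ᶠ ψ) = mapᶠ g φ ∨ᶠ mapᶠ g ψ

-- The sublattice 𝔽(I) of 𝔽 = Face Name / ≈ᶠ: its elements are the lattice
-- terms in the generators from I, compared in 𝔽.
𝔽 : FinSet → Setoid 0ℓ 0ℓ
𝔽 I = On.setoid (face-setoid Name) (mapᶠ {El I} name)

infix 4 _≈𝔽_
_≈𝔽_ : ∀ {I} → Face (El I) → Face (El I) → Set
_≈𝔽_ {I} = Setoid._≈_ (𝔽 I)

-- (r = 1) and (1 - r = 1); negation exchanges the two, which gives the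
-- clauses for the latter.
⌊_=1⌋ ⌊1-_=1⌋ : DM X → Face X
⌊ var x =1⌋ = ⟨ x =1⟩
⌊ 𝟎     =1⌋ = 0𝔽
⌊ 𝟏     =1⌋ = 1𝔽
⌊ s ∧ t =1⌋ = ⌊ s =1⌋ ∧ᶠ ⌊ t =1⌋
⌊ s ∨ t =1⌋ = ⌊ s =1⌋ ∨ᶠ ⌊ t =1⌋
⌊ ~ s   =1⌋ = ⌊1- s =1⌋
⌊1- var x =1⌋ = ⟨ x =0⟩
⌊1- 𝟎     =1⌋ = 1𝔽
⌊1- 𝟏     =1⌋ = 0𝔽
⌊1- s ∧ t =1⌋ = ⌊1- s =1⌋ ∨ᶠ ⌊1- t =1⌋
⌊1- s ∨ t =1⌋ = ⌊1- s =1⌋ ∧ᶠ ⌊1- t =1⌋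
⌊1- ~ s   =1⌋ = ⌊ s =1⌋

infixl 8 _[_]
_[_] : ∀ {I J} → Face (El J) → Hom I J → Face (El I)
⟨ j =0⟩  [ f ] = ⌊ ~ f j =1⌋
⟨ j =1⟩  [ f ] = ⌊ f j =1⌋
0𝔽       [ f ] = 0𝔽
1𝔽       [ f ] = 1𝔽
(φ ∧ᶠ ψ) [ f ] = φ [ f ] ∧ᶠ ψ [ f ]
(φ ∨ᶠ ψ) [ f ] = φ [ f ] ∨ᶠ ψ [ f ]

Cube : FinSet → Setoid (lsuc 0ℓ) 0ℓ
Cube I = record
  { Carrier = El I → Interval
  ; _≈_     = λ u v → ∀ i → u i ≈ᴵ v i
  ; isEquivalence = record
    { refl  = λ {u} i → 𝕀.refl {u i}
    ; sym   = λ {u} {v} p i → 𝕀.sym {u i} {v i} (p i)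
    ; trans = λ {u} {v} {w} p q i → 𝕀.trans {u i} {v i} {w i} (p i) (q i)
    }
  }
  where module 𝕀 = DeMorganAlgebra 𝕀

Cyl : FinSet → Setoid (lsuc 0ℓ) 0ℓ
Cyl I = Cube I ×ₛ DeMorganAlgebra.setoid 𝕀

infix 4 _≈ᶜ_
_≈ᶜ_ : ∀ {I} → Setoid.Carrier (Cyl I) → Setoid.Carrier (Cyl I) → Set
_≈ᶜ_ {I} = Setoid._≈_ (Cyl I)

-- ∂_I u = 1.
OnBoundary : ∀ {I} → (El I → Interval) → Set
OnBoundary u = ∃ λ i → u i ≈ᴵ 0ᴵ ⊎ u i ≈ᴵ 1ᴵ

act : ∀ {I J} → Hom I J → (El I → Interval) → (El J → Interval)
act f u j = eval 𝕀 (f j) u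

_×id : ∀ {I J} → Hom I J → Setoid.Carrier (Cyl I) → Setoid.Carrier (Cyl J)
f ×id = map₁ (act f)

{-# OPTIONS --safe #-}

-- Constant coordinates of f factor through faces, where the equation is
-- hypothesis (d); so f may be taken strict.  Then ψ = 1 iff ψ f = 1, and if
-- ψ ≠ 1 both sides are unchanged when x is replaced by r_I x.  This is a fixed
-- point of r_I, so it has z = 0 or lies on a face (ib), where (d) reduces the
-- equation for f to the one for f (ib), whose domain is smaller.
module Submission where

open import Defs
open import Data.Bool.Base using (Bool; true; false; T; if_then_else_)
import Data.Bool.Base as Bool
import Data.Bool.Properties as Bool
open import Data.List.Base using (length)
open import Data.List.Membership.DecPropositional using (_∈?_)
open import Data.List.Membership.Propositional using (_∈_; lose)
open import Data.List.Membership.Propositional.Properties using (∈-filter⁻)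
open import Data.List.Properties using (filter-notAll)
open import Data.List.Relation.Unary.Any using (any?; satisfied)
import Data.List.Relation.Unary.Any as Any
open import Data.Nat.Base as ℕ using (ℕ; _+_)
open import Data.Nat.Induction using (<-wellFounded)
import Data.Nat.Properties as ℕ
open import Data.Product.Base using (_×_; _,_; ∃; ∃₂; proj₁; proj₂)
open import Data.Sum.Base using (_⊎_; inj₁; inj₂)
open import Function.Base using (_∘_)
open import Function.Bundles using (Func; _⟨$⟩_; _⇔_; Equivalence)
open import Function.Relation.Binary.Setoid.Equality using (_⇨_)
open import Induction.WellFounded using (Acc; acc)
open import Level using (Level)
open import Relation.Binary.Bundles using (Setoid)
open import Relation.Binary.PropositionalEquality.Core
  using (_≡_; refl; sym; trans; cong; cong₂; subst)
import Relation.Binary.Reasoning.Setoid as SetoidReasoning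
open import Relation.Nullary using (¬_; Dec; yes; no; ¬?; recompute)
open import Relation.Nullary.Decidable using (map′)

private variable
  c ℓ : Level
  X Y : Set
  I J K : FinSet

-- Evaluation and substitution

module _ (A : DeMorganAlgebra c ℓ) where
  private module A = DeMorganAlgebra A

  eval-≈ : ∀ {s t : DM X} u → s ≈ᴰ t → eval A s u A.≈ eval A t u
  eval-≈ u ≈-refl            = A.refl
  eval-≈ u (≈-sym p)         = A.sym (eval-≈ u p)
  eval-≈ u (≈-trans p q)     = A.trans (eval-≈ u p) (eval-≈ u q)
  eval-≈ u (∧-cong p q)      = A.∧-cong (eval-≈ u p) (eval-≈ u q)
  eval-≈ u (∨-cong p q)      = A.∨-cong (eval-≈ u p) (eval-≈ u q)
  eval-≈ u (~-cong p)        = A.~-cong (eval-≈ u p)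
  eval-≈ u (∧-comm _ _)      = A.∧-comm _ _
  eval-≈ u (∨-comm _ _)      = A.∨-comm _ _
  eval-≈ u (∧-assoc _ _ _)   = A.∧-assoc _ _ _
  eval-≈ u (∨-assoc _ _ _)   = A.∨-assoc _ _ _
  eval-≈ u (∧-absorbs _ _)   = A.∧-absorbs-∨ _ _
  eval-≈ u (∨-absorbs _ _)   = A.∨-absorbs-∧ _ _
  eval-≈ u (∧-distrib _ _ _) = A.∧-distribˡ-∨ _ _ _
  eval-≈ u (∨-distrib _ _ _) = A.∨-distribˡ-∧ _ _ _
  eval-≈ u (∧-unit _)        = proj₁ A.∧-identity _
  eval-≈ u (∨-unit _)        = proj₁ A.∨-identity _
  eval-≈ u (~-invol _)       = A.~-involutive _
  eval-≈ u (deMorgan _ _)    = A.deMorgan _ _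

  eval-cong : ∀ (s : DM X) {u v} → (∀ x → u x A.≈ v x) → eval A s u A.≈ eval A s v
  eval-cong (var x) p = p x
  eval-cong 𝟎       p = A.refl
  eval-cong 𝟏       p = A.refl
  eval-cong (s ∧ t) p = A.∧-cong (eval-cong s p) (eval-cong t p)
  eval-cong (s ∨ t) p = A.∨-cong (eval-cong s p) (eval-cong t p)
  eval-cong (~ s)   p = A.~-cong (eval-cong s p)

  eval-subst : ∀ (s : DM X) (g : X → DM Y) u →
               eval A (eval (dM Y) s g) u ≡ eval A s (λ x → eval A (g x) u)
  eval-subst (var x) g u = refl
  eval-subst 𝟎       g u = refl
  eval-subst 𝟏       g u = refl
  eval-subst (s ∧ t) g u = cong₂ A._∧_ (eval-subst s g u) (eval-subst t g u)
  eval-subst (s ∨ t) g u = cong₂ A._∨_ (eval-subst s g u) (eval-subst t g u)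
  eval-subst (~ s)   g u = cong A.~_ (eval-subst s g u)

infixr 9 _⊙_
-- Composition is evaluation in the free algebra, so lemmas about `eval` in an arbitrary algebra
-- also apply to morphisms.
_⊙_ : Hom J K → Hom I J → Hom I K
_⊙_ {I = I} f g k = eval (dM (El I)) (f k) g

-- Faces

-- Opaque because η-contraction would otherwise identify ∖⊆ with the identity,
-- ignoring the change of type.
opaque
  ∖⊆ : ∀ {n} → El (I ∖ n) → El I
  ∖⊆ {I} {n} (el k m) = el k (proj₁ (∈-filter⁻ (λ j → ¬? (j ℕ.≟ n)) {xs = FinSet.names I} m))

  name-∖⊆ : ∀ {n} (k : El (I ∖ n)) → El.name (∖⊆ {I} k) ≡ El.name k
  name-∖⊆ k = refl

name-injective : ∀ {i j : El I} → El.name i ≡ El.name j → i ≡ j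
name-injective refl = refl

-- Turns the case split inside `face` into equations. In the second case only the name of `k′`
-- matters, since membership proofs are irrelevant.
face-cases : ∀ (i : El I) b k →
             (El.name k ≡ El.name i × face i b k ≡ endpoint b) ⊎
             (∃ λ k′ → El.name k′ ≡ El.name k × face i b k ≡ var k′)
face-cases i b (el k m) with k ℕ.≟ El.name i
... | yes e = inj₁ (e , refl)
... | no _  = inj₂ (_ , refl , refl)

module _ (A : DeMorganAlgebra c ℓ) where
  private module A = DeMorganAlgebra A

  eval-endpoint : ∀ b (u : X → A.Carrier) → eval A (endpoint b) u A.≈ (if b then A.⊤ else A.⊥)
  eval-endpoint true  u = A.refl
  eval-endpoint false u = A.refl

  -- Stated for any algebra because it is used twice: in `𝕀` it puts a boundary point in the image
  -- of a face map, and in `dM` it factors a morphism with a constant coordinate through a face.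
  eval-face : ∀ (i : El I) b (u : El I → A.Carrier) → u i A.≈ (if b then A.⊤ else A.⊥) →
              ∀ k → eval A (face i b k) (u ∘ ∖⊆) A.≈ u k
  eval-face i b u p k with face-cases i b k
  ... | inj₁ (n , e) rewrite e | name-injective {i = k} {i} n =
        A.trans (eval-endpoint b (u ∘ ∖⊆ {n = El.name i})) (A.sym p)
  ... | inj₂ (k′ , n , e)
        rewrite e | name-injective {i = ∖⊆ k′} {k} (trans (name-∖⊆ k′) n) = A.refl

card : FinSet → ℕ
card I = length (FinSet.names I)

-- The irrelevant proof can be recovered because list membership is decidable.
name-∈ : (i : El I) → El.name i ∈ FinSet.names I
name-∈ {I} (el n m) = recompute (_∈?_ ℕ._≟_ n (FinSet.names I)) m

card-∖ : (i : El I) → card (I ∖ El.name i) ℕ.< card I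
card-∖ {I} i = filter-notAll (λ j → ¬? (j ℕ.≟ El.name i)) (FinSet.names I)
                 (Any.map (λ e ne → ne (sym e)) (name-∈ i))

-- Face formulas

-- Mutual because negation swaps the two maps. Lattice axioms go to themselves under the first and
-- to their duals under the second; involution and De Morgan become reflexivity.
⌊⌋-cong   : ∀ {s t : DM X} → s ≈ᴰ t → ⌊ s =1⌋ ≈ᶠ ⌊ t =1⌋
⌊1-⌋-cong : ∀ {s t : DM X} → s ≈ᴰ t → ⌊1- s =1⌋ ≈ᶠ ⌊1- t =1⌋

⌊⌋-cong ≈-refl            = ≈-refl
⌊⌋-cong (≈-sym p)         = ≈-sym (⌊⌋-cong p)
⌊⌋-cong (≈-trans p q)     = ≈-trans (⌊⌋-cong p) (⌊⌋-cong q)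
⌊⌋-cong (∧-cong p q)      = ∧-cong (⌊⌋-cong p) (⌊⌋-cong q)
⌊⌋-cong (∨-cong p q)      = ∨-cong (⌊⌋-cong p) (⌊⌋-cong q)
⌊⌋-cong (~-cong p)        = ⌊1-⌋-cong p
⌊⌋-cong (∧-comm _ _)      = ∧-comm _ _
⌊⌋-cong (∨-comm _ _)      = ∨-comm _ _
⌊⌋-cong (∧-assoc _ _ _)   = ∧-assoc _ _ _
⌊⌋-cong (∨-assoc _ _ _)   = ∨-assoc _ _ _
⌊⌋-cong (∧-absorbs _ _)   = ∧-absorbs _ _
⌊⌋-cong (∨-absorbs _ _)   = ∨-absorbs _ _
⌊⌋-cong (∧-distrib _ _ _) = ∧-distrib _ _ _
⌊⌋-cong (∨-distrib _ _ _) = ∨-distrib _ _ _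
⌊⌋-cong (∧-unit _)        = ∧-unit _
⌊⌋-cong (∨-unit _)        = ∨-unit _
⌊⌋-cong (~-invol _)       = ≈-refl
⌊⌋-cong (deMorgan _ _)    = ≈-refl

⌊1-⌋-cong ≈-refl            = ≈-refl
⌊1-⌋-cong (≈-sym p)         = ≈-sym (⌊1-⌋-cong p)
⌊1-⌋-cong (≈-trans p q)     = ≈-trans (⌊1-⌋-cong p) (⌊1-⌋-cong q)
⌊1-⌋-cong (∧-cong p q)      = ∨-cong (⌊1-⌋-cong p) (⌊1-⌋-cong q)
⌊1-⌋-cong (∨-cong p q)      = ∧-cong (⌊1-⌋-cong p) (⌊1-⌋-cong q)
⌊1-⌋-cong (~-cong p)        = ⌊⌋-cong p
⌊1-⌋-cong (∧-comm _ _)      = ∨-comm _ _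
⌊1-⌋-cong (∨-comm _ _)      = ∧-comm _ _
⌊1-⌋-cong (∧-assoc _ _ _)   = ∨-assoc _ _ _
⌊1-⌋-cong (∨-assoc _ _ _)   = ∧-assoc _ _ _
⌊1-⌋-cong (∧-absorbs _ _)   = ∨-absorbs _ _
⌊1-⌋-cong (∨-absorbs _ _)   = ∧-absorbs _ _
⌊1-⌋-cong (∧-distrib _ _ _) = ∨-distrib _ _ _
⌊1-⌋-cong (∨-distrib _ _ _) = ∧-distrib _ _ _
⌊1-⌋-cong (∧-unit _)        = ∨-unit _
⌊1-⌋-cong (∨-unit _)        = ∧-unit _
⌊1-⌋-cong (~-invol _)       = ≈-refl
⌊1-⌋-cong (deMorgan _ _)    = ≈-refl

[]-cong : ∀ {f g : Hom I J} ψ → (∀ j → f j ≈ᴰ g j) → ψ [ f ] ≈ᶠ ψ [ g ]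
[]-cong ⟨ j =0⟩  p = ⌊1-⌋-cong (p j)
[]-cong ⟨ j =1⟩  p = ⌊⌋-cong (p j)
[]-cong 0𝔽       p = ≈-refl
[]-cong 1𝔽       p = ≈-refl
[]-cong (φ ∧ᶠ ψ) p = ∧-cong ([]-cong φ p) ([]-cong ψ p)
[]-cong (φ ∨ᶠ ψ) p = ∨-cong ([]-cong φ p) ([]-cong ψ p)

⌊subst⌋   : ∀ (s : DM (El J)) (g : Hom I J) → ⌊ eval (dM (El I)) s g =1⌋ ≡ ⌊ s =1⌋ [ g ]
⌊1-subst⌋ : ∀ (s : DM (El J)) (g : Hom I J) → ⌊1- eval (dM (El I)) s g =1⌋ ≡ ⌊1- s =1⌋ [ g ]

⌊subst⌋ (var _) g = refl
⌊subst⌋ 𝟎       g = refl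
⌊subst⌋ 𝟏       g = refl
⌊subst⌋ (s ∧ t) g = cong₂ _∧ᶠ_ (⌊subst⌋ s g) (⌊subst⌋ t g)
⌊subst⌋ (s ∨ t) g = cong₂ _∨ᶠ_ (⌊subst⌋ s g) (⌊subst⌋ t g)
⌊subst⌋ (~ s)   g = ⌊1-subst⌋ s g

⌊1-subst⌋ (var _) g = refl
⌊1-subst⌋ 𝟎       g = refl
⌊1-subst⌋ 𝟏       g = refl
⌊1-subst⌋ (s ∧ t) g = cong₂ _∨ᶠ_ (⌊1-subst⌋ s g) (⌊1-subst⌋ t g)
⌊1-subst⌋ (s ∨ t) g = cong₂ _∧ᶠ_ (⌊1-subst⌋ s g) (⌊1-subst⌋ t g)
⌊1-subst⌋ (~ s)   g = ⌊subst⌋ s g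

-- Functoriality of substitution holds on the nose, since every map involved is defined by recursion
-- on terms.
[]-⊙ : ∀ ψ (f : Hom J K) (g : Hom I J) → ψ [ f ⊙ g ] ≡ ψ [ f ] [ g ]
[]-⊙ ⟨ k =0⟩  f g = ⌊1-subst⌋ (f k) g
[]-⊙ ⟨ k =1⟩  f g = ⌊subst⌋ (f k) g
[]-⊙ 0𝔽       f g = refl
[]-⊙ 1𝔽       f g = refl
[]-⊙ (φ ∧ᶠ ψ) f g = cong₂ _∧ᶠ_ ([]-⊙ φ f g) ([]-⊙ ψ f g)
[]-⊙ (φ ∨ᶠ ψ) f g = cong₂ _∨ᶠ_ ([]-⊙ φ f g) ([]-⊙ ψ f g)

-- Carries equations between formulas over `El I` to `𝔽 I`, whose equality is tested over all names.
mapᶠ-cong : ∀ (g : X → Y) {φ ψ} → φ ≈ᶠ ψ → mapᶠ g φ ≈ᶠ mapᶠ g ψ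
mapᶠ-cong g ≈-refl            = ≈-refl
mapᶠ-cong g (≈-sym p)         = ≈-sym (mapᶠ-cong g p)
mapᶠ-cong g (≈-trans p q)     = ≈-trans (mapᶠ-cong g p) (mapᶠ-cong g q)
mapᶠ-cong g (∧-cong p q)      = ∧-cong (mapᶠ-cong g p) (mapᶠ-cong g q)
mapᶠ-cong g (∨-cong p q)      = ∨-cong (mapᶠ-cong g p) (mapᶠ-cong g q)
mapᶠ-cong g (∧-comm _ _)      = ∧-comm _ _
mapᶠ-cong g (∨-comm _ _)      = ∨-comm _ _
mapᶠ-cong g (∧-assoc _ _ _)   = ∧-assoc _ _ _
mapᶠ-cong g (∨-assoc _ _ _)   = ∨-assoc _ _ _
mapᶠ-cong g (∧-absorbs _ _)   = ∧-absorbs _ _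
mapᶠ-cong g (∨-absorbs _ _)   = ∨-absorbs _ _
mapᶠ-cong g (∧-distrib _ _ _) = ∧-distrib _ _ _
mapᶠ-cong g (∨-distrib _ _ _) = ∨-distrib _ _ _
mapᶠ-cong g (∧-unit _)        = ∧-unit _
mapᶠ-cong g (∨-unit _)        = ∨-unit _
mapᶠ-cong g (0∧1-empty _)     = 0∧1-empty _

-- Recognising 1 and strictness

-- The lattice map 𝔽 → Bool killing all generators; its fibre over true is {1}.
isOne : Face X → Bool
isOne ⟨ _ =0⟩  = false
isOne ⟨ _ =1⟩  = false
isOne 0𝔽       = false
isOne 1𝔽       = true
isOne (φ ∧ᶠ ψ) = isOne φ Bool.∧ isOne ψ
isOne (φ ∨ᶠ ψ) = isOne φ Bool.∨ isOne ψ

isOne-cong : ∀ {φ ψ : Face X} → φ ≈ᶠ ψ → isOne φ ≡ isOne ψ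
isOne-cong ≈-refl            = refl
isOne-cong (≈-sym p)         = sym (isOne-cong p)
isOne-cong (≈-trans p q)     = trans (isOne-cong p) (isOne-cong q)
isOne-cong (∧-cong p q)      = cong₂ Bool._∧_ (isOne-cong p) (isOne-cong q)
isOne-cong (∨-cong p q)      = cong₂ Bool._∨_ (isOne-cong p) (isOne-cong q)
isOne-cong (∧-comm φ ψ)      = Bool.∧-comm (isOne φ) (isOne ψ)
isOne-cong (∨-comm φ ψ)      = Bool.∨-comm (isOne φ) (isOne ψ)
isOne-cong (∧-assoc φ ψ χ)   = Bool.∧-assoc (isOne φ) (isOne ψ) (isOne χ)
isOne-cong (∨-assoc φ ψ χ)   = Bool.∨-assoc (isOne φ) (isOne ψ) (isOne χ)
isOne-cong (∧-absorbs φ ψ)   = Bool.∧-abs-∨ (isOne φ) (isOne ψ)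
isOne-cong (∨-absorbs φ ψ)   = Bool.∨-abs-∧ (isOne φ) (isOne ψ)
isOne-cong (∧-distrib φ ψ χ) = Bool.∧-distribˡ-∨ (isOne φ) (isOne ψ) (isOne χ)
isOne-cong (∨-distrib φ ψ χ) = Bool.∨-distribˡ-∧ (isOne φ) (isOne ψ) (isOne χ)
isOne-cong (∧-unit _)        = refl
isOne-cong (∨-unit _)        = refl
isOne-cong (0∧1-empty _)     = refl

isOne-mapᶠ : ∀ (g : X → Y) φ → isOne (mapᶠ g φ) ≡ isOne φ
isOne-mapᶠ g ⟨ _ =0⟩  = refl
isOne-mapᶠ g ⟨ _ =1⟩  = refl
isOne-mapᶠ g 0𝔽       = refl
isOne-mapᶠ g 1𝔽       = refl
isOne-mapᶠ g (φ ∧ᶠ ψ) = cong₂ Bool._∧_ (isOne-mapᶠ g φ) (isOne-mapᶠ g ψ)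
isOne-mapᶠ g (φ ∨ᶠ ψ) = cong₂ Bool._∨_ (isOne-mapᶠ g φ) (isOne-mapᶠ g ψ)

T-∧⁻ : ∀ {a b} → T (a Bool.∧ b) → T a × T b
T-∧⁻ = Equivalence.to Bool.T-∧

T-∨⁻ : ∀ {a b} → T (a Bool.∨ b) → T a ⊎ T b
T-∨⁻ = Equivalence.to Bool.T-∨

-- The recursion works because a true disjunction in `Bool` has a true disjunct; the other one is
-- then absorbed.
isOne⇒≈1 : ∀ (φ : Face X) → T (isOne φ) → φ ≈ᶠ 1𝔽
isOne⇒≈1 1𝔽       _ = ≈-refl
isOne⇒≈1 (φ ∧ᶠ ψ) t with T-∧⁻ t
... | p , q = ≈-trans (∧-cong (isOne⇒≈1 φ p) (isOne⇒≈1 ψ q)) (∧-unit 1𝔽)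
isOne⇒≈1 (φ ∨ᶠ ψ) t with T-∨⁻ {isOne φ} t
-- Writing `ψ` as `1𝔽 ∧ᶠ ψ` makes absorption applicable.
... | inj₁ p = ≈-trans (∨-cong (isOne⇒≈1 φ p) (≈-sym (∧-unit ψ))) (∨-absorbs 1𝔽 ψ)
... | inj₂ q = ≈-trans (∨-comm φ ψ)
                 (≈-trans (∨-cong (isOne⇒≈1 ψ q) (≈-sym (∧-unit φ))) (∨-absorbs 1𝔽 φ))

isOne⇒≈𝔽1 : ∀ (φ : Face (El I)) → T (isOne φ) → _≈𝔽_ {I} φ 1𝔽
isOne⇒≈𝔽1 φ t = mapᶠ-cong El.name (isOne⇒≈1 φ t)

≈𝔽1⇒isOne : ∀ (φ : Face (El I)) → _≈𝔽_ {I} φ 1𝔽 → T (isOne φ)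
≈𝔽1⇒isOne φ p = subst T (trans (sym (isOne-cong p)) (isOne-mapᶠ El.name φ)) _

𝟎∧ : ∀ (s : DM X) → 𝟎 ∧ s ≈ᴰ 𝟎
𝟎∧ s = ≈-trans (∧-cong ≈-refl (≈-sym (∨-unit s))) (∧-absorbs 𝟎 s)

𝟏∨ : ∀ (s : DM X) → 𝟏 ∨ s ≈ᴰ 𝟏
𝟏∨ s = ≈-trans (∨-cong ≈-refl (≈-sym (∧-unit s))) (∨-absorbs 𝟏 s)

-- Not an axiom: `~ 𝟏` is `~ (~ 𝟎) ∨ ~ 𝟏`, which is `~ (~ 𝟎 ∧ 𝟏)` by De Morgan, hence `~ (~ 𝟎)`.
~𝟏 : _≈ᴰ_ {X} (~ 𝟏) 𝟎
~𝟏 = ≈-trans (≈-sym (∨-unit _))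
    (≈-trans (∨-cong (≈-sym (~-invol 𝟎)) ≈-refl)
    (≈-trans (≈-sym (deMorgan (~ 𝟎) 𝟏))
    (≈-trans (~-cong (≈-trans (∧-comm _ _) (∧-unit _))) (~-invol 𝟎))))

~𝟎 : _≈ᴰ_ {X} (~ 𝟎) 𝟏
~𝟎 = ≈-trans (~-cong (≈-sym ~𝟏)) (~-invol 𝟏)

-- Together with the congruence lemmas, this makes equality with `𝟎` or `𝟏` in the free algebra
-- decidable without normal forms.
isOne⌊⌋⇒≈𝟏   : ∀ (s : DM X) → T (isOne ⌊ s =1⌋) → s ≈ᴰ 𝟏
isOne⌊1-⌋⇒≈𝟎 : ∀ (s : DM X) → T (isOne ⌊1- s =1⌋) → s ≈ᴰ 𝟎

isOne⌊⌋⇒≈𝟏 𝟏       _ = ≈-refl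
isOne⌊⌋⇒≈𝟏 (s ∧ t) h with T-∧⁻ h
... | p , q = ≈-trans (∧-cong (isOne⌊⌋⇒≈𝟏 s p) (isOne⌊⌋⇒≈𝟏 t q)) (∧-unit 𝟏)
isOne⌊⌋⇒≈𝟏 (s ∨ t) h with T-∨⁻ {isOne ⌊ s =1⌋} h
... | inj₁ p = ≈-trans (∨-cong (isOne⌊⌋⇒≈𝟏 s p) ≈-refl) (𝟏∨ t)
... | inj₂ q = ≈-trans (∨-comm s t) (≈-trans (∨-cong (isOne⌊⌋⇒≈𝟏 t q) ≈-refl) (𝟏∨ s))
isOne⌊⌋⇒≈𝟏 (~ s)   h = ≈-trans (~-cong (isOne⌊1-⌋⇒≈𝟎 s h)) ~𝟎

isOne⌊1-⌋⇒≈𝟎 𝟎       _ = ≈-refl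
isOne⌊1-⌋⇒≈𝟎 (s ∧ t) h with T-∨⁻ {isOne ⌊1- s =1⌋} h
... | inj₁ p = ≈-trans (∧-cong (isOne⌊1-⌋⇒≈𝟎 s p) ≈-refl) (𝟎∧ t)
... | inj₂ q = ≈-trans (∧-comm s t) (≈-trans (∧-cong (isOne⌊1-⌋⇒≈𝟎 t q) ≈-refl) (𝟎∧ s))
isOne⌊1-⌋⇒≈𝟎 (s ∨ t) h with T-∧⁻ h
... | p , q = ≈-trans (∨-cong (isOne⌊1-⌋⇒≈𝟎 s p) (isOne⌊1-⌋⇒≈𝟎 t q)) (∨-unit 𝟎)
isOne⌊1-⌋⇒≈𝟎 (~ s)   h = ≈-trans (~-cong (isOne⌊⌋⇒≈𝟏 s h)) ~𝟏

-- Both sides respect the lattice operations, so generators suffice, and strictness keeps their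
-- images different from 1.
isOne-strict : ∀ (f : Hom I J) → Strict f → ∀ ψ → isOne (ψ [ f ]) ≡ isOne ψ
isOne-strict f st ⟨ j =0⟩  = Bool.¬-not (λ e → proj₁ (st j) (isOne⌊1-⌋⇒≈𝟎 (f j) (subst T (sym e) _)))
isOne-strict f st ⟨ j =1⟩  = Bool.¬-not (λ e → proj₂ (st j) (isOne⌊⌋⇒≈𝟏 (f j) (subst T (sym e) _)))
isOne-strict f st 0𝔽       = refl
isOne-strict f st 1𝔽       = refl
isOne-strict f st (φ ∧ᶠ ψ) = cong₂ Bool._∧_ (isOne-strict f st φ) (isOne-strict f st ψ)
isOne-strict f st (φ ∨ᶠ ψ) = cong₂ Bool._∨_ (isOne-strict f st φ) (isOne-strict f st ψ)

Constant : DM X → Set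
Constant s = ∃ λ b → s ≈ᴰ endpoint b

constant? : (s : DM X) → Dec (Constant s)
constant? s with Bool.T? (isOne ⌊ s =1⌋) | Bool.T? (isOne ⌊1- s =1⌋)
... | yes p | _     = yes (true , isOne⌊⌋⇒≈𝟏 s p)
... | no _  | yes q = yes (false , isOne⌊1-⌋⇒≈𝟎 s q)
... | no ¬p | no ¬q = no λ where
  (true  , e) → ¬p (subst T (sym (isOne-cong (⌊⌋-cong e))) _)
  (false , e) → ¬q (subst T (sym (isOne-cong (⌊1-⌋-cong e))) _)

constant⊎strict : (f : Hom I J) → (∃ λ j → Constant (f j)) ⊎ Strict f
constant⊎strict {J = J} f with any? constantAt? (FinSet.names J)
  where
  -- The search runs over bare names, so the predicate must supply the membership proof needed to
  -- form a coordinate of `f`.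
  constantAt? : ∀ n → Dec (∃ λ (m : n ∈ FinSet.names J) → Constant (f (el n m)))
  constantAt? n with _∈?_ ℕ._≟_ n (FinSet.names J)
  ... | yes m = map′ (m ,_) proj₂ (constant? (f (el n m)))
  ... | no ∉J = no (∉J ∘ proj₁)
... | yes a with satisfied a
...   | n , m , h = inj₁ (el n m , h)
constant⊎strict f | no ¬a = inj₂ λ j →
  (λ e → ¬a (lose (name-∈ j) (name-∈ j , false , e))) ,
  (λ e → ¬a (lose (name-∈ j) (name-∈ j , true , e)))

-- The action on cylinders

×id-cong : ∀ (f : Hom I J) x y → _≈ᶜ_ {I} x y → _≈ᶜ_ {J} ((f ×id) x) ((f ×id) y)
×id-cong f _ _ (p , q) = (λ j → eval-cong 𝕀 (f j) p) , q

×id-≈ : ∀ {f g : Hom I J} → (∀ j → f j ≈ᴰ g j) → ∀ x → _≈ᶜ_ {J} ((f ×id) x) ((g ×id) x)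
×id-≈ p (u , z) = (λ j → eval-≈ 𝕀 u (p j)) , DeMorganAlgebra.refl 𝕀 {z}

×id-⊙ : ∀ (f : Hom J K) (g : Hom I J) x → _≈ᶜ_ {K} (((f ⊙ g) ×id) x) ((f ×id) ((g ×id) x))
×id-⊙ f g (u , z) =
  (λ k → DeMorganAlgebra.reflexive 𝕀 (eval-subst 𝕀 (f k) g u)) , DeMorganAlgebra.refl 𝕀 {z}

onBoundary⇒face : ∀ (u : El I → Interval) → OnBoundary u →
                  ∃₂ λ i b → ∀ k → act (face i b) (u ∘ ∖⊆) k ≈ᴵ u k
onBoundary⇒face u (i , inj₁ p) = i , false , eval-face 𝕀 i false u p
onBoundary⇒face u (i , inj₂ p) = i , true  , eval-face 𝕀 i true u p

-- Closure properties of the morphisms that satisfy the equation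

module _ (rᶠ : ∀ I → Func (𝔽 I) (Cyl I ⇨ Cyl I)) where

  -- All `ψ` at once, because composition needs the equation for the inner map at `ψ [ f ]`.
  Commutes : Hom I J → Set₁
  Commutes {I} {J} f = ∀ ψ x →
    rᶠ J ⟨$⟩ ψ ⟨$⟩ (f ×id) x ≈ᶜ (f ×id) (rᶠ I ⟨$⟩ ψ [ f ] ⟨$⟩ x)

  rᶠ-congᶠ : ∀ {φ ψ : Face (El I)} → φ ≈ᶠ ψ → ∀ x → rᶠ I ⟨$⟩ φ ⟨$⟩ x ≈ᶜ rᶠ I ⟨$⟩ ψ ⟨$⟩ x
  rᶠ-congᶠ {I} p = Func.cong (rᶠ I) (mapᶠ-cong El.name p)

  rᶠ-congᶜ : ∀ (ψ : Face (El I)) {x y} → x ≈ᶜ y → rᶠ I ⟨$⟩ ψ ⟨$⟩ x ≈ᶜ rᶠ I ⟨$⟩ ψ ⟨$⟩ y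
  rᶠ-congᶜ {I} ψ = Func.cong (rᶠ I ⟨$⟩ ψ)

  -- Needed because morphisms are terms, and factorisations through faces hold only up to `≈ᴰ`.
  commutes-≈ : ∀ {f g : Hom I J} → (∀ j → f j ≈ᴰ g j) → Commutes f → Commutes g
  commutes-≈ {I} {J} {f} {g} p F ψ x = begin
    rᶠ J ⟨$⟩ ψ ⟨$⟩ (g ×id) x           ≈⟨ rᶠ-congᶜ ψ (×id-≈ p x) ⟨
    rᶠ J ⟨$⟩ ψ ⟨$⟩ (f ×id) x           ≈⟨ F ψ x ⟩
    (f ×id) (rᶠ I ⟨$⟩ ψ [ f ] ⟨$⟩ x)   ≈⟨ ×id-≈ p (rᶠ I ⟨$⟩ ψ [ f ] ⟨$⟩ x) ⟩
    (g ×id) (rᶠ I ⟨$⟩ ψ [ f ] ⟨$⟩ x)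
      ≈⟨ ×id-cong g (rᶠ I ⟨$⟩ ψ [ f ] ⟨$⟩ x) (rᶠ I ⟨$⟩ ψ [ g ] ⟨$⟩ x) (rᶠ-congᶠ ([]-cong ψ p) x) ⟩
    (g ×id) (rᶠ I ⟨$⟩ ψ [ g ] ⟨$⟩ x)   ∎
    where open SetoidReasoning (Cyl J)

  commutes-⊙ : ∀ {f : Hom J K} {g : Hom I J} → Commutes f → Commutes g → Commutes (f ⊙ g)
  commutes-⊙ {J} {K} {I} {f} {g} F G ψ x = begin
    rᶠ K ⟨$⟩ ψ ⟨$⟩ ((f ⊙ g) ×id) x                   ≈⟨ rᶠ-congᶜ ψ (×id-⊙ f g x) ⟩
    rᶠ K ⟨$⟩ ψ ⟨$⟩ (f ×id) ((g ×id) x)               ≈⟨ F ψ _ ⟩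
    (f ×id) (rᶠ J ⟨$⟩ ψ [ f ] ⟨$⟩ (g ×id) x)
      ≈⟨ ×id-cong f (rᶠ J ⟨$⟩ ψ [ f ] ⟨$⟩ (g ×id) x) ((g ×id) (rᶠ I ⟨$⟩ ψ [ f ] [ g ] ⟨$⟩ x))
           (G (ψ [ f ]) x) ⟩
    (f ×id) ((g ×id) (rᶠ I ⟨$⟩ ψ [ f ] [ g ] ⟨$⟩ x)) ≈⟨ ×id-⊙ f g (rᶠ I ⟨$⟩ ψ [ f ] [ g ] ⟨$⟩ x) ⟨
    ((f ⊙ g) ×id) (rᶠ I ⟨$⟩ ψ [ f ] [ g ] ⟨$⟩ x)
      ≡⟨ cong (λ φ → ((f ⊙ g) ×id) (rᶠ I ⟨$⟩ φ ⟨$⟩ x)) ([]-⊙ ψ f g) ⟨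
    ((f ⊙ g) ×id) (rᶠ I ⟨$⟩ ψ [ f ⊙ g ] ⟨$⟩ x)       ∎
    where open SetoidReasoning (Cyl K)

  -- A partial converse to composition: on points coming from `g`, the equation for `f` can be
  -- recovered from those for `f ⊙ g` and `g`.
  commutes-on-image : ∀ {f : Hom J K} {g : Hom I J} → Commutes (f ⊙ g) → Commutes g → ∀ ψ x →
    rᶠ K ⟨$⟩ ψ ⟨$⟩ (f ×id) ((g ×id) x) ≈ᶜ (f ×id) (rᶠ J ⟨$⟩ ψ [ f ] ⟨$⟩ (g ×id) x)
  commutes-on-image {J} {K} {I} {f} {g} FG G ψ x = begin
    rᶠ K ⟨$⟩ ψ ⟨$⟩ (f ×id) ((g ×id) x)               ≈⟨ rᶠ-congᶜ ψ (×id-⊙ f g x) ⟨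
    rᶠ K ⟨$⟩ ψ ⟨$⟩ ((f ⊙ g) ×id) x                   ≈⟨ FG ψ x ⟩
    ((f ⊙ g) ×id) (rᶠ I ⟨$⟩ ψ [ f ⊙ g ] ⟨$⟩ x)
      ≡⟨ cong (λ φ → ((f ⊙ g) ×id) (rᶠ I ⟨$⟩ φ ⟨$⟩ x)) ([]-⊙ ψ f g) ⟩
    ((f ⊙ g) ×id) (rᶠ I ⟨$⟩ ψ [ f ] [ g ] ⟨$⟩ x)     ≈⟨ ×id-⊙ f g (rᶠ I ⟨$⟩ ψ [ f ] [ g ] ⟨$⟩ x) ⟩
    (f ×id) ((g ×id) (rᶠ I ⟨$⟩ ψ [ f ] [ g ] ⟨$⟩ x))
      ≈⟨ ×id-cong f (rᶠ J ⟨$⟩ ψ [ f ] ⟨$⟩ (g ×id) x) ((g ×id) (rᶠ I ⟨$⟩ ψ [ f ] [ g ] ⟨$⟩ x))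
           (G (ψ [ f ]) x) ⟨
    (f ×id) (rᶠ J ⟨$⟩ ψ [ f ] ⟨$⟩ (g ×id) x)         ∎
    where open SetoidReasoning (Cyl K)

-- Induction on the total number of names

theoremC1 : (r : ∀ I → Func (Cyl I) (Cyl I)) →
    (∀ I x → r I ⟨$⟩ (r I ⟨$⟩ x) ≈ᶜ r I ⟨$⟩ x) →
    (∀ I u z → (r I ⟨$⟩ (u , z) ≈ᶜ (u , z)) ⇔ (OnBoundary u ⊎ z ≈ᴵ 0ᴵ)) →
    (∀ {I J} (f : Hom I J) → Strict f → ∀ x → r J ⟨$⟩ (f ×id) (r I ⟨$⟩ x) ≈ᶜ r J ⟨$⟩ (f ×id) x) →
    (rᶠ : ∀ I → Func (𝔽 I) (Cyl I ⇨ Cyl I)) →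
    (∀ I ψ → ψ ≈𝔽 1𝔽 → ∀ x → rᶠ I ⟨$⟩ ψ ⟨$⟩ x ≈ᶜ x) →
    (∀ I ψ → ¬ (ψ ≈𝔽 1𝔽) → ∀ x → rᶠ I ⟨$⟩ ψ ⟨$⟩ x ≈ᶜ rᶠ I ⟨$⟩ ψ ⟨$⟩ (r I ⟨$⟩ x)) →
    (∀ I ψ u z → z ≈ᴵ 0ᴵ → rᶠ I ⟨$⟩ ψ ⟨$⟩ (u , z) ≈ᶜ (u , z)) →
    (∀ I ψ (i : El I) (b : Bool) x →
    rᶠ I ⟨$⟩ ψ ⟨$⟩ (face i b ×id) x ≈ᶜ (face i b ×id) (rᶠ (I ∖ El.name i) ⟨$⟩ ψ [ face i b ] ⟨$⟩ x)) →
    ∀ {I J} (f : Hom I J) (ψ : Face (El J)) x →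
    rᶠ J ⟨$⟩ ψ ⟨$⟩ (f ×id) x ≈ᶜ (f ×id) (rᶠ I ⟨$⟩ ψ [ f ] ⟨$⟩ x)
theoremC1 r r-idem r-fixed r-strict rᶠ rᶠ-1 rᶠ-≢1 rᶠ-z≈0 rᶠ-face f = go f (<-wellFounded _)
  where
  face-commutes : ∀ (i : El I) b → Commutes rᶠ (face i b)
  face-commutes {I} i b ψ = rᶠ-face I ψ i b

  -- The measure adds both cardinalities: removing a constant coordinate shrinks the codomain,
  -- restricting to a face shrinks the domain.
  go : ∀ (f : Hom I J) → Acc ℕ._<_ (card I + card J) → Commutes rᶠ f
  go {I} {J} f (acc rs) with constant⊎strict f
  ... | inj₁ (j , b , fj≈b) =
        -- `eval-face` in the free algebra shows that `f` is `face j b` after `f` with coordinate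
        -- `j` dropped.
        commutes-≈ rᶠ (eval-face (dM (El I)) j b f fj≈b)
          (commutes-⊙ rᶠ (face-commutes j b)
            (go (f ∘ ∖⊆) (rs (ℕ.+-monoʳ-< (card I) (card-∖ j)))))
  ... | inj₂ f-strict = commutes
    where
    on-fixed : ∀ ψ u z → OnBoundary u ⊎ z ≈ᴵ 0ᴵ →
      rᶠ J ⟨$⟩ ψ ⟨$⟩ (f ×id) (u , z) ≈ᶜ (f ×id) (rᶠ I ⟨$⟩ ψ [ f ] ⟨$⟩ (u , z))
    on-fixed ψ u z (inj₂ z≈0) = begin
      rᶠ J ⟨$⟩ ψ ⟨$⟩ (f ×id) (u , z)         ≈⟨ rᶠ-z≈0 J ψ (act f u) z z≈0 ⟩
      (f ×id) (u , z)
        ≈⟨ ×id-cong f (rᶠ I ⟨$⟩ ψ [ f ] ⟨$⟩ (u , z)) (u , z) (rᶠ-z≈0 I (ψ [ f ]) u z z≈0) ⟨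
      (f ×id) (rᶠ I ⟨$⟩ ψ [ f ] ⟨$⟩ (u , z)) ∎
      where open SetoidReasoning (Cyl J)
    on-fixed ψ u z (inj₁ ∂u) with onBoundary⇒face u ∂u
    ... | i , b , u≈ = begin
      rᶠ J ⟨$⟩ ψ ⟨$⟩ (f ×id) (u , z)           ≈⟨ rᶠ-congᶜ rᶠ ψ (×id-cong f y (u , z) y≈) ⟨
      rᶠ J ⟨$⟩ ψ ⟨$⟩ (f ×id) y
        -- The composite with the face need not be strict, so the induction has to range over all
        -- morphisms.
        ≈⟨ commutes-on-image rᶠ (go (f ⊙ face i b) (rs (ℕ.+-monoˡ-< (card J) (card-∖ i))))
             (face-commutes i b) ψ (u ∘ ∖⊆ , z) ⟩
      (f ×id) (rᶠ I ⟨$⟩ ψ [ f ] ⟨$⟩ y)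
        ≈⟨ ×id-cong f (rᶠ I ⟨$⟩ ψ [ f ] ⟨$⟩ y) (rᶠ I ⟨$⟩ ψ [ f ] ⟨$⟩ (u , z))
             (rᶠ-congᶜ rᶠ (ψ [ f ]) y≈) ⟩
      (f ×id) (rᶠ I ⟨$⟩ ψ [ f ] ⟨$⟩ (u , z))   ∎
      where
      open SetoidReasoning (Cyl J)
      y : Setoid.Carrier (Cyl I)
      y = (face i b ×id) (u ∘ ∖⊆ , z)
      y≈ : _≈ᶜ_ {I} y (u , z)
      y≈ = u≈ , DeMorganAlgebra.refl 𝕀 {z}

    commutes : Commutes rᶠ f
    -- The Boolean test decides between (a) and (b), and strictness gives the same answer for
    -- `ψ [ f ]`.
    commutes ψ x with Bool.T? (isOne ψ)
    ... | yes t = begin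
      rᶠ J ⟨$⟩ ψ ⟨$⟩ (f ×id) x         ≈⟨ rᶠ-1 J ψ (isOne⇒≈𝔽1 ψ t) _ ⟩
      (f ×id) x
        ≈⟨ ×id-cong f (rᶠ I ⟨$⟩ ψ [ f ] ⟨$⟩ x) x (rᶠ-1 I (ψ [ f ]) ψf≈1 x) ⟨
      (f ×id) (rᶠ I ⟨$⟩ ψ [ f ] ⟨$⟩ x) ∎
      where
      open SetoidReasoning (Cyl J)
      ψf≈1 : _≈𝔽_ {I} (ψ [ f ]) 1𝔽
      ψf≈1 = isOne⇒≈𝔽1 (ψ [ f ]) (subst T (sym (isOne-strict f f-strict ψ)) t)
    ... | no ¬t = begin
      -- By (b), `r J` is inserted so that (2) can place `r I` in front of `x`, and is then removed
      -- again.
      rᶠ J ⟨$⟩ ψ ⟨$⟩ (f ×id) x                         ≈⟨ rᶠ-≢1 J ψ ψ≢1 _ ⟩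
      rᶠ J ⟨$⟩ ψ ⟨$⟩ (r J ⟨$⟩ (f ×id) x)               ≈⟨ rᶠ-congᶜ rᶠ ψ (r-strict f f-strict x) ⟨
      rᶠ J ⟨$⟩ ψ ⟨$⟩ (r J ⟨$⟩ (f ×id) (r I ⟨$⟩ x))     ≈⟨ rᶠ-≢1 J ψ ψ≢1 _ ⟨
      rᶠ J ⟨$⟩ ψ ⟨$⟩ (f ×id) (r I ⟨$⟩ x)
        -- By idempotence `r I ⟨$⟩ x` is a fixed point of `r I`, so (1) yields the required
        -- alternative.
        ≈⟨ on-fixed ψ _ _ (Equivalence.to (r-fixed I _ _) (r-idem I x)) ⟩
      (f ×id) (rᶠ I ⟨$⟩ ψ [ f ] ⟨$⟩ (r I ⟨$⟩ x))
        ≈⟨ ×id-cong f (rᶠ I ⟨$⟩ ψ [ f ] ⟨$⟩ x) (rᶠ I ⟨$⟩ ψ [ f ] ⟨$⟩ (r I ⟨$⟩ x))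
             (rᶠ-≢1 I (ψ [ f ]) ψf≢1 x) ⟨
      (f ×id) (rᶠ I ⟨$⟩ ψ [ f ] ⟨$⟩ x)                 ∎
      where
      open SetoidReasoning (Cyl J)
      ψ≢1 : ¬ (_≈𝔽_ {J} ψ 1𝔽)
      ψ≢1 = ¬t ∘ ≈𝔽1⇒isOne ψ
      ψf≢1 : ¬ (_≈𝔽_ {I} (ψ [ f ]) 1𝔽)
      ψf≢1 = ¬t ∘ subst T (isOne-strict f f-strict ψ) ∘ ≈𝔽1⇒isOne (ψ [ f ])
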